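{- The following series identity holds: $$\sum_{k=0}^{\infty}\left(\frac{1}{4}\right)^k\frac{(1)_k^2}{(\frac{5}{4})_k(\frac{7}{4})_k}\left\{\frac{5+6k}{1+2k}H_{k}^{(2)}-\frac{24+32k}{(1+2k)^3}\right\}=-24\beta(4).$$
   Context: For a complex number $x$ and a nonnegative integer $n$, the shifted factorial is $(x)_0=1$ and $(x)_n=x(x+1)\cdots(x+n-1)$ for $n\ge 1$; $(x)_n^m$ denotes $((x)_n)^m$. The harmonic numbers of order 2 are $H_n^{(2)}=\sum_{j=1}^n \frac{1}{j^2}$, with $H_0^{(2)}=0$. The constant $\beta(4)$ is $\beta(4)=\sum_{k=0}^{\infty}\frac{(-1)^k}{(1+2k)^4}$. -}

module Defs where

import Algebra.Definitions.RawSemiring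
open import Data.Integer.Base as ℤ using (+_; +[1+_])
import Data.Integer.Properties as ℤ
open import Data.Nat.Base as ℕ using (ℕ; zero; suc)
import Data.Nat.Properties as ℕ
open import Data.Nat.Tactic.RingSolver using (solve-∀)
open import Data.Product.Base using (∃; _×_; _,_)
open import Data.Rational.Base as ℚ hiding (_<_; _-_; ∣_∣)
open import Data.Rational.Properties
import Data.Rational.Unnormalised.Base as ℚᵘ
import Data.Rational.Unnormalised.Properties as ℚᵘ
open import Data.Rational.Solver
open import Data.Sum.Base using (inj₁; inj₂)
open import Function.Base using (_∘_)
open import Relation.Binary.PropositionalEquality

open Algebra.Definitions.RawSemiring +-*-rawSemiring public using (_^_)
open +-*-Solver using (solve; _:+_; _:*_; _:-_; :-_; _:=_; con)

pos½* : ∀ {ε} → 0ℚ ℚ.< ε → 0ℚ ℚ.< ½ * ε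
pos½* {ε} 0<ε = positive⁻¹ (½ * ε) {{pos*pos⇒pos ½ ε {{positive 0<ε}}}}

halves : ∀ ε → ½ * ε + ½ * ε ≡ ε
halves ε = trans (sym (*-distribʳ-+ ε ½ ½)) (*-identityˡ ε)

∣-∣-sym : ∀ p q → ℚ.∣ p ℚ.- q ∣ ≡ ℚ.∣ q ℚ.- p ∣
∣-∣-sym p q = trans
  (cong ℚ.∣_∣ (solve 2 (λ p q → p :- q := :- (q :- p)) refl p q))
  (∣-p∣≡∣p∣ (q ℚ.- p))

∣+∣<-halves : ∀ ε {x} p q → x ≡ p + q →
              ℚ.∣ p ∣ ℚ.< ½ * ε → ℚ.∣ q ∣ ℚ.< ½ * ε → ℚ.∣ x ∣ ℚ.< ε
∣+∣<-halves ε p q refl u v = ≤-<-trans (∣p+q∣≤∣p∣+∣q∣ p q)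
  (subst (ℚ.∣ p ∣ + ℚ.∣ q ∣ ℚ.<_) (halves ε) (+-mono-< u v))

reverse-triangle : ∀ p q → ℚ.∣ p ∣ ℚ.- ℚ.∣ q ∣ ≤ ℚ.∣ p ℚ.- q ∣
reverse-triangle p q = begin
  ℚ.∣ p ∣ ℚ.- ℚ.∣ q ∣
    ≡⟨ cong (λ z → ℚ.∣ z ∣ ℚ.- ℚ.∣ q ∣)
         (solve 2 (λ p q → p := (p :- q) :+ q) refl p q) ⟩
  ℚ.∣ (p ℚ.- q) + q ∣ ℚ.- ℚ.∣ q ∣
    ≤⟨ +-monoˡ-≤ (- ℚ.∣ q ∣) (∣p+q∣≤∣p∣+∣q∣ (p ℚ.- q) q) ⟩
  (ℚ.∣ p ℚ.- q ∣ + ℚ.∣ q ∣) ℚ.- ℚ.∣ q ∣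
    ≡⟨ solve 2 (λ a b → (a :+ b) :- b := a) refl ℚ.∣ p ℚ.- q ∣ ℚ.∣ q ∣ ⟩
  ℚ.∣ p ℚ.- q ∣ ∎
  where open ≤-Reasoning

∣∣-∣∣-≤ : ∀ p q → ℚ.∣ ℚ.∣ p ∣ ℚ.- ℚ.∣ q ∣ ∣ ≤ ℚ.∣ p ℚ.- q ∣
∣∣-∣∣-≤ p q with ∣p∣≡p∨∣p∣≡-p (ℚ.∣ p ∣ ℚ.- ℚ.∣ q ∣)
... | inj₁ eq = subst (_≤ ℚ.∣ p ℚ.- q ∣) (sym eq) (reverse-triangle p q)
... | inj₂ eq = subst₂ _≤_
  (trans (solve 2 (λ a b → b :- a := :- (a :- b)) refl ℚ.∣ p ∣ ℚ.∣ q ∣) (sym eq))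
  (∣-∣-sym q p) (reverse-triangle q p)

IsCauchy : (ℕ → ℚ) → Set
IsCauchy s = ∀ ε → 0ℚ ℚ.< ε →
  ∃ λ N → ∀ m n → N ℕ.≤ m → N ℕ.≤ n → ℚ.∣ s m ℚ.- s n ∣ ℚ.< ε

record ℝ : Set where
  constructor mkℝ
  field
    seq    : ℕ → ℚ
    cauchy : IsCauchy seq

open ℝ public

infix 4 _<_
infixl 6 _-_
infixl 7 _·_

-- The rational gap δ makes this the strict order of the limits.
_<_ : ℝ → ℝ → Set
x < y = ∃ λ δ → 0ℚ ℚ.< δ × ∃ λ N → ∀ n → N ℕ.≤ n → seq x n + δ ≤ seq y n

fromℚ : ℚ → ℝ
fromℚ q = mkℝ (λ _ → q) λ ε 0<ε →
  0 , λ _ _ _ _ → subst (ℚ._< ε) (sym (cong ℚ.∣_∣ (+-inverseʳ q))) 0<ε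

_-_ : ℝ → ℝ → ℝ
x - y = mkℝ (λ n → seq x n ℚ.- seq y n) λ ε 0<ε →
  let M , f = cauchy x (½ * ε) (pos½* 0<ε)
      N , g = cauchy y (½ * ε) (pos½* 0<ε)
  in M ℕ.⊔ N , λ m n p q → ∣+∣<-halves ε
       (seq x m ℚ.- seq x n) (seq y n ℚ.- seq y m)
       (solve 4 (λ a b c d → (a :- b) :- (c :- d) := (a :- c) :+ (d :- b))
          refl (seq x m) (seq y m) (seq x n) (seq y n))
       (f m n (ℕ.m⊔n≤o⇒m≤o M N p) (ℕ.m⊔n≤o⇒m≤o M N q))
       (g n m (ℕ.m⊔n≤o⇒n≤o M N q) (ℕ.m⊔n≤o⇒n≤o M N p))

∣_∣ : ℝ → ℝ
∣ x ∣ = mkℝ (ℚ.∣_∣ ∘ seq x) λ ε 0<ε →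
  let N , f = cauchy x ε 0<ε
  in N , λ m n p q → ≤-<-trans (∣∣-∣∣-≤ (seq x m) (seq x n)) (f m n p q)

_·_ : ℚ → ℝ → ℝ
q · x = mkℝ (λ n → q * seq x n) λ ε 0<ε →
  let b     = 1ℚ + ℚ.∣ q ∣
      instance
        b>0 : Positive b
        b>0 = pos+nonNeg⇒pos 1ℚ ℚ.∣ q ∣ {{nonNegative (0≤∣p∣ q)}}
        b≢0 : NonZero b
        b≢0 = pos⇒nonZero b
      0<ε/b = positive⁻¹ ((1/ b) * ε)
                {{pos*pos⇒pos (1/ b) {{1/pos⇒pos b}} ε {{positive 0<ε}}}}
      N , f = cauchy x ((1/ b) * ε) 0<ε/b
  in N , λ m n i j →
    let d = ℚ.∣ seq x m ℚ.- seq x n ∣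
        open ≤-Reasoning
    in begin-strict
      ℚ.∣ q * seq x m ℚ.- q * seq x n ∣
        ≡⟨ cong ℚ.∣_∣ (solve 3 (λ q a b → q :* a :- q :* b := q :* (a :- b))
             refl q (seq x m) (seq x n)) ⟩
      ℚ.∣ q * (seq x m ℚ.- seq x n) ∣
        ≡⟨ ∣p*q∣≡∣p∣*∣q∣ q (seq x m ℚ.- seq x n) ⟩
      ℚ.∣ q ∣ * d
        ≡⟨ +-identityˡ (ℚ.∣ q ∣ * d) ⟨
      0ℚ + ℚ.∣ q ∣ * d
        ≤⟨ +-monoˡ-≤ (ℚ.∣ q ∣ * d) (0≤∣p∣ (seq x m ℚ.- seq x n)) ⟩
      d + ℚ.∣ q ∣ * d
        ≡⟨ solve 2 (λ c d → d :+ c :* d := (con 1ℚ :+ c) :* d) refl ℚ.∣ q ∣ d ⟩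
      b * d
        <⟨ *-monoʳ-<-pos b (f m n i j) ⟩
      b * ((1/ b) * ε)
        ≡⟨ *-assoc b (1/ b) ε ⟨
      b * (1/ b) * ε
        ≡⟨ cong (_* ε) (*-inverseʳ b) ⟩
      1ℚ * ε
        ≡⟨ *-identityˡ ε ⟩
      ε ∎

∑[k<_] : ℕ → (ℕ → ℚ) → ℚ
∑[k< zero  ] a = 0ℚ
∑[k< suc n ] a = ∑[k< n ] a + a n

HasSum : (ℕ → ℚ) → ℝ → Set
HasSum a x = ∀ ε → 0ℚ ℚ.< ε →
  ∃ λ N → ∀ n → N ℕ.≤ n → ∣ fromℚ (∑[k< n ] a) - x ∣ < fromℚ ε

∑∞ : (a : ℕ → ℚ) → IsCauchy (λ n → ∑[k< n ] a) → ℝ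
∑∞ a c = mkℝ (λ n → ∑[k< n ] a) c

∑∞-hasSum : ∀ a c → HasSum a (∑∞ a c)
∑∞-hasSum a c ε 0<ε =
  let N , f = c (½ * ε) (pos½* 0<ε)
  in N , λ n N≤n → ½ * ε , pos½* 0<ε , N , λ m N≤m →
       let open ≤-Reasoning in begin
         ℚ.∣ ∑[k< n ] a ℚ.- ∑[k< m ] a ∣ + ½ * ε
           ≤⟨ +-monoˡ-≤ (½ * ε) (<⇒≤ (f n m N≤n N≤m)) ⟩
         ½ * ε + ½ * ε
           ≡⟨ halves ε ⟩
         ε ∎

private
  telescope : ∀ (a T : ℕ → ℚ) → (∀ k → T (suc k) + ℚ.∣ a k ∣ ≤ T k) →
              ∀ m d → ℚ.∣ ∑[k< d ℕ.+ m ] a ℚ.- ∑[k< m ] a ∣ + T (d ℕ.+ m) ≤ T m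
  telescope a T h m zero = ≤-reflexive (trans
    (cong (λ z → ℚ.∣ z ∣ + T m) (+-inverseʳ (∑[k< m ] a))) (+-identityˡ (T m)))
  telescope a T h m (suc d) = begin
    ℚ.∣ (S + t) ℚ.- S₀ ∣ + T (suc n)
      ≡⟨ cong (λ z → ℚ.∣ z ∣ + T (suc n))
           (solve 3 (λ s t r → (s :+ t) :- r := (s :- r) :+ t) refl S t S₀) ⟩
    ℚ.∣ (S ℚ.- S₀) + t ∣ + T (suc n)
      ≤⟨ +-monoˡ-≤ (T (suc n)) (∣p+q∣≤∣p∣+∣q∣ (S ℚ.- S₀) t) ⟩
    (ℚ.∣ S ℚ.- S₀ ∣ + ℚ.∣ t ∣) + T (suc n)
      ≡⟨ solve 3 (λ s t r → (s :+ t) :+ r := s :+ (r :+ t)) refl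
           ℚ.∣ S ℚ.- S₀ ∣ ℚ.∣ t ∣ (T (suc n)) ⟩
    ℚ.∣ S ℚ.- S₀ ∣ + (T (suc n) + ℚ.∣ t ∣)
      ≤⟨ +-monoʳ-≤ ℚ.∣ S ℚ.- S₀ ∣ (h n) ⟩
    ℚ.∣ S ℚ.- S₀ ∣ + T n
      ≤⟨ telescope a T h m d ⟩
    T m ∎
    where
    open ≤-Reasoning
    n = d ℕ.+ m
    S = ∑[k< n ] a
    S₀ = ∑[k< m ] a
    t = a n

telescoping⇒cauchy : ∀ (a T : ℕ → ℚ) →
  (∀ k → T (suc k) + ℚ.∣ a k ∣ ≤ T k) → (∀ k → 0ℚ ≤ T k) →
  (∀ ε → 0ℚ ℚ.< ε → ∃ λ N → T N ℚ.< ε) →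
  IsCauchy (λ n → ∑[k< n ] a)
telescoping⇒cauchy a T h T≥0 T→0 ε 0<ε =
  let N , TN<ε/2 = T→0 (½ * ε) (pos½* 0<ε)
      S = λ n → ∑[k< n ] a
      near : ∀ {n} → N ℕ.≤ n → ℚ.∣ S n ℚ.- S N ∣ ℚ.< ½ * ε
      near {n} N≤n =
        let d = ℚ.∣ S n ℚ.- S N ∣
            open ≤-Reasoning
        in begin-strict
          d           ≡⟨ +-identityʳ d ⟨
          d + 0ℚ      ≤⟨ +-monoʳ-≤ d (T≥0 n) ⟩
          d + T n     ≤⟨ subst (λ z → ℚ.∣ S z ℚ.- S N ∣ + T z ≤ T N)
                           (ℕ.m∸n+n≡m N≤n) (telescope a T h N (n ℕ.∸ N)) ⟩
          T N         <⟨ TN<ε/2 ⟩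
          ½ * ε       ∎
  in N , λ m n N≤m N≤n → ∣+∣<-halves ε (S m ℚ.- S N) (S N ℚ.- S n)
       (solve 3 (λ a b c → a :- b := (a :- c) :+ (c :- b)) refl (S m) (S n) (S N))
       (near N≤m)
       (subst (ℚ._< ½ * ε) (∣-∣-sym (S n) (S N)) (near N≤n))

β4-term : ℕ → ℚ
β4-term k = (- 1ℚ) ^ k * (+ 1 / (1 ℕ.+ 2 ℕ.* k) ℕ.^ 4)

private
  ∣[-1]^k∣≡1 : ∀ k → ℚ.∣ (- 1ℚ) ^ k ∣ ≡ 1ℚ
  ∣[-1]^k∣≡1 zero    = refl
  ∣[-1]^k∣≡1 (suc k) = trans (∣p*q∣≡∣p∣*∣q∣ (- 1ℚ) ((- 1ℚ) ^ k))
    (cong (1ℚ *_) (∣[-1]^k∣≡1 k))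

  tail : ℕ → ℚ
  tail k = + 2 / suc k

  tail≥0 : ∀ k → 0ℚ ≤ tail k
  tail≥0 k = nonNegative⁻¹ (tail k) {{normalize-nonNeg 2 (suc k)}}

  lhs : ∀ k d → (2 ℕ.* suc d ℕ.+ 1 ℕ.* suc (suc k)) ℕ.* suc k
              ≡ 2 ℕ.* suc d ℕ.* suc k ℕ.+ suc (suc k) ℕ.* suc k
  lhs = solve-∀

  rhs : ∀ k d → 2 ℕ.* suc d ℕ.* suc k ℕ.+ 2 ℕ.* suc d
              ≡ 2 ℕ.* (suc (suc k) ℕ.* suc d)
  rhs = solve-∀

  expand : ∀ k → suc (suc k) ℕ.* suc k ℕ.+
             (13 ℕ.* k ℕ.+ 47 ℕ.* (k ℕ.* k) ℕ.+ 64 ℕ.* (k ℕ.* k ℕ.* k)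
              ℕ.+ 32 ℕ.* (k ℕ.* k ℕ.* k ℕ.* k))
           ≡ 2 ℕ.* ((1 ℕ.+ 2 ℕ.* k) ℕ.* ((1 ℕ.+ 2 ℕ.* k) ℕ.*
               ((1 ℕ.+ 2 ℕ.* k) ℕ.* ((1 ℕ.+ 2 ℕ.* k) ℕ.* 1))))
  expand = solve-∀

  step : ∀ k d → suc (suc k) ℕ.* suc k ℕ.≤ 2 ℕ.* suc d →
         tail (suc k) + (+ 1 / suc d) ≤ tail k
  step k d le = toℚᵘ-cancel-≤ (begin
    toℚᵘ (tail (suc k) + (+ 1 / suc d))
      ≃⟨ toℚᵘ-homo-+ (tail (suc k)) (+ 1 / suc d) ⟩
    toℚᵘ (tail (suc k)) ℚᵘ.+ toℚᵘ (+ 1 / suc d)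
      ≃⟨ ℚᵘ.+-cong (toℚᵘ-fromℚᵘ (ℚᵘ.mkℚᵘ (+ 2) (suc k)))
                   (toℚᵘ-fromℚᵘ (ℚᵘ.mkℚᵘ (+ 1) d)) ⟩
    ℚᵘ.mkℚᵘ (+ 2) (suc k) ℚᵘ.+ ℚᵘ.mkℚᵘ (+ 1) d
      ≤⟨ ℚᵘ.*≤* (ℤ.+≤+ core) ⟩
    ℚᵘ.mkℚᵘ (+ 2) k
      ≃⟨ toℚᵘ-fromℚᵘ (ℚᵘ.mkℚᵘ (+ 2) k) ⟨
    toℚᵘ (tail k) ∎)
    where
    open ℚᵘ.≤-Reasoning
    core : (2 ℕ.* suc d ℕ.+ 1 ℕ.* suc (suc k)) ℕ.* suc k
           ℕ.≤ 2 ℕ.* (suc (suc k) ℕ.* suc d)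
    core = subst₂ ℕ._≤_ (sym (lhs k d)) (rhs k d)
             (ℕ.+-monoʳ-≤ (2 ℕ.* suc d ℕ.* suc k) le)

  bound : ∀ k → suc (suc k) ℕ.* suc k ℕ.≤ 2 ℕ.* (1 ℕ.+ 2 ℕ.* k) ℕ.^ 4
  bound k = ℕ.≤-trans (ℕ.m≤m+n _ _) (ℕ.≤-reflexive (expand k))

  β4-telescopes : ∀ k → tail (suc k) + ℚ.∣ β4-term k ∣ ≤ tail k
  β4-telescopes k =
    subst (λ z → tail (suc k) + z ≤ tail k) (sym abs)
      (step k (ℕ.pred ((1 ℕ.+ 2 ℕ.* k) ℕ.^ 4)) (bound k))
    where
    r = + 1 / (1 ℕ.+ 2 ℕ.* k) ℕ.^ 4
    abs : ℚ.∣ β4-term k ∣ ≡ r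
    abs = trans (∣p*q∣≡∣p∣*∣q∣ ((- 1ℚ) ^ k) r) (trans
      (cong₂ _*_ (∣[-1]^k∣≡1 k)
        (0≤p⇒∣p∣≡p (nonNegative⁻¹ r {{normalize-nonNeg 1 ((1 ℕ.+ 2 ℕ.* k) ℕ.^ 4)}})))
      (*-identityˡ r))

  tail→0 : ∀ ε → 0ℚ ℚ.< ε → ∃ λ N → tail N ℚ.< ε
  tail→0 ε 0<ε = go ε {{positive 0<ε}}
    where
    go : ∀ ε → .{{Positive ε}} → ∃ λ N → tail N ℚ.< ε
    go ε@(mkℚ +[1+ p ] q _) = 2 ℕ.* suc q , toℚᵘ-cancel-< (begin-strict
      toℚᵘ (tail (2 ℕ.* suc q))
        ≃⟨ toℚᵘ-fromℚᵘ (ℚᵘ.mkℚᵘ (+ 2) (2 ℕ.* suc q)) ⟩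
      ℚᵘ.mkℚᵘ (+ 2) (2 ℕ.* suc q)
        <⟨ ℚᵘ.*<* (ℤ.+<+ (ℕ.m≤m+n (suc (2 ℕ.* suc q)) (p ℕ.* suc (2 ℕ.* suc q)))) ⟩
      toℚᵘ ε ∎)
      where open ℚᵘ.≤-Reasoning

β4 : ℝ
β4 = ∑∞ β4-term (telescoping⇒cauchy β4-term tail β4-telescopes tail≥0 tail→0)

β4-hasSum : HasSum β4-term β4
β4-hasSum = ∑∞-hasSum β4-term (cauchy β4)

-- The shifted factorial (x)ₙ; only rational x occur in the series.
⟨_⟩_ : ℚ → ℕ → ℚ
⟨ x ⟩ zero  = 1ℚ
⟨ x ⟩ suc n = ⟨ x ⟩ n * (x + + n / 1)

⟨⟩-pos : ∀ x .{{_ : Positive x}} n → Positive (⟨ x ⟩ n)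
⟨⟩-pos x zero    = _
⟨⟩-pos x (suc n) = pos*pos⇒pos (⟨ x ⟩ n) {{⟨⟩-pos x n}} (x + + n / 1)
  {{pos+nonNeg⇒pos x (+ n / 1) {{normalize-nonNeg n 1}}}}

H⁽²⁾ : ℕ → ℚ
H⁽²⁾ n = ∑[k< n ] λ j → + 1 / suc j ℕ.^ 2

term : ℕ → ℚ
term k =
  (+ 1 / 4) ^ k
  * (((⟨ 1ℚ ⟩ k) ^ 2) ÷ (⟨ + 5 / 4 ⟩ k * ⟨ + 7 / 4 ⟩ k))
  * ((+ (5 ℕ.+ 6 ℕ.* k) / (1 ℕ.+ 2 ℕ.* k)) * H⁽²⁾ k
     ℚ.- (+ (24 ℕ.+ 32 ℕ.* k) / (1 ℕ.+ 2 ℕ.* k) ℕ.^ 3))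
  where instance
    denominator≢0 : NonZero (⟨ + 5 / 4 ⟩ k * ⟨ + 7 / 4 ⟩ k)
    denominator≢0 = pos⇒nonZero (⟨ + 5 / 4 ⟩ k * ⟨ + 7 / 4 ⟩ k) {{pos*pos⇒pos
      (⟨ + 5 / 4 ⟩ k) {{⟨⟩-pos (+ 5 / 4) k}}
      (⟨ + 7 / 4 ⟩ k) {{⟨⟩-pos (+ 7 / 4) k}}}}

{-# OPTIONS --safe #-}
module Submission where

-- A WZ pair with a parameter.  Put (1±x)ₙ = (1-x)ₙ(1+x)ₙ, a = 2n+2k+1 and
--   F(n,k) = (-1)ᵏ (1±x)ₙ (1/2)ₖ / (3/2)₂ₙ₊ₖ · a / (a² - 4x²),
--   D(n,k) = -(-1)ᵏ (1±x)ₙ (1/2)ₖ / (4 (3/2)₂ₙ₊ₖ₊₁),   G = F + D.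
-- Then F(n+1,k) - F(n,k) = G(n,k+1) - G(n,k).  All functions below are the
-- coefficients of 4x² in these, where (1±x)ₙ = n!² (1 - x² Hₙ⁽²⁾ + …) produces
-- the harmonic numbers.  F(0,k) is the k-th term of β(4), and -24 G(n,0) is the
-- n-th term of the series; summing over the square [0,N)² leaves the two far
-- sides, which are O(1/N).

open import Defs
open import Data.Integer.Base using (+_)
open import Data.Rational.Base using (_/_; -_)
open import Data.Integer.Base as ℤ using (+[1+_])
import Data.Integer.Properties as ℤ
open import Data.Nat.Base as ℕ using (ℕ; zero; suc)
import Data.Nat.Properties as ℕ
open import Data.Nat.Tactic.RingSolver using (solve-∀)
open import Data.Product.Base using (∃; _×_; _,_; proj₁; proj₂)
open import Data.Rational.Base as ℚ
  using (ℚ; mkℚ; 0ℚ; 1ℚ; ½; _+_; _*_; _≤_; 1/_; _÷_; NonZero; Positive;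
         toℚᵘ; positive; nonNegative)
open import Data.Rational.Properties
import Data.Rational.Unnormalised.Base as ℚᵘ
import Data.Rational.Unnormalised.Properties as ℚᵘ
open import Data.Rational.Solver
open import Data.Sum.Base using (inj₁; inj₂)
open import Relation.Binary.PropositionalEquality
open +-*-Solver using (solve; _:+_; _:*_; _:-_; :-_; _:=_; con)

-- Arithmetic of fractions of natural numbers inside ℚ.

toℚᵘ-/ : ∀ p q .{{_ : ℕ.NonZero q}} → toℚᵘ (+ p / q) ℚᵘ.≃ (+ p ℚᵘ./ q)
toℚᵘ-/ p q@(suc q-1) = toℚᵘ-fromℚᵘ (ℚᵘ.mkℚᵘ (+ p) q-1)

/-mono : ∀ p q r s .{{_ : ℕ.NonZero q}} .{{_ : ℕ.NonZero s}} →
         p ℕ.* s ℕ.≤ r ℕ.* q → + p / q ≤ + r / s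
/-mono p q@(suc _) r s@(suc _) le = toℚᵘ-cancel-≤ (begin
  toℚᵘ (+ p / q)  ≃⟨ toℚᵘ-/ p q ⟩
  + p ℚᵘ./ q      ≤⟨ ℚᵘ.*≤* (subst₂ ℤ._≤_ (ℤ.pos-* p s) (ℤ.pos-* r q) (ℤ.+≤+ le)) ⟩
  + r ℚᵘ./ s      ≃⟨ toℚᵘ-/ r s ⟨
  toℚᵘ (+ r / s)  ∎)
  where open ℚᵘ.≤-Reasoning

/-≡ : ∀ p q r s .{{_ : ℕ.NonZero q}} .{{_ : ℕ.NonZero s}} →
      p ℕ.* s ≡ r ℕ.* q → + p / q ≡ + r / s
/-≡ p q r s eq = ≤-antisym
  (/-mono p q r s (ℕ.≤-reflexive eq)) (/-mono r s p q (ℕ.≤-reflexive (sym eq)))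

/-* : ∀ p q r s .{{_ : ℕ.NonZero q}} .{{_ : ℕ.NonZero s}} .{{_ : ℕ.NonZero (q ℕ.* s)}} →
      (+ p / q) * (+ r / s) ≡ + (p ℕ.* r) / (q ℕ.* s)
/-* p q@(suc _) r s@(suc _) = toℚᵘ-injective (begin
  toℚᵘ ((+ p / q) * (+ r / s))       ≈⟨ toℚᵘ-homo-* (+ p / q) (+ r / s) ⟩
  toℚᵘ (+ p / q) ℚᵘ.* toℚᵘ (+ r / s) ≈⟨ ℚᵘ.*-cong (toℚᵘ-/ p q) (toℚᵘ-/ r s) ⟩
  (+ p ℚᵘ./ q) ℚᵘ.* (+ r ℚᵘ./ s)     ≡⟨ cong (ℚᵘ._/ (q ℕ.* s)) (ℤ.pos-* p r) ⟨
  + (p ℕ.* r) ℚᵘ./ (q ℕ.* s)         ≈⟨ toℚᵘ-/ (p ℕ.* r) (q ℕ.* s) ⟨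
  toℚᵘ (+ (p ℕ.* r) / (q ℕ.* s))     ∎)
  where open ℚᵘ.≃-Reasoning

/-+ : ∀ p q r s .{{_ : ℕ.NonZero q}} .{{_ : ℕ.NonZero s}} .{{_ : ℕ.NonZero (q ℕ.* s)}} →
      (+ p / q) + (+ r / s) ≡ + (p ℕ.* s ℕ.+ r ℕ.* q) / (q ℕ.* s)
/-+ p q@(suc _) r s@(suc _) = toℚᵘ-injective (begin
  toℚᵘ ((+ p / q) + (+ r / s))       ≈⟨ toℚᵘ-homo-+ (+ p / q) (+ r / s) ⟩
  toℚᵘ (+ p / q) ℚᵘ.+ toℚᵘ (+ r / s) ≈⟨ ℚᵘ.+-cong (toℚᵘ-/ p q) (toℚᵘ-/ r s) ⟩
  (+ p ℚᵘ./ q) ℚᵘ.+ (+ r ℚᵘ./ s)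
    ≡⟨ cong (ℚᵘ._/ (q ℕ.* s))
         (trans (ℤ.pos-+ (p ℕ.* s) (r ℕ.* q)) (cong₂ ℤ._+_ (ℤ.pos-* p s) (ℤ.pos-* r q))) ⟨
  + (p ℕ.* s ℕ.+ r ℕ.* q) ℚᵘ./ (q ℕ.* s) ≈⟨ toℚᵘ-/ (p ℕ.* s ℕ.+ r ℕ.* q) (q ℕ.* s) ⟨
  toℚᵘ (+ (p ℕ.* s ℕ.+ r ℕ.* q) / (q ℕ.* s)) ∎)
  where open ℚᵘ.≃-Reasoning

/-nonNeg : ∀ p q .{{_ : ℕ.NonZero q}} → 0ℚ ≤ + p / q
/-nonNeg p q = nonNegative⁻¹ (+ p / q) {{normalize-nonNeg p q}}

ι : ℕ → ℚ
ι n = + n / 1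

inv : ∀ n .{{_ : ℕ.NonZero n}} → ℚ
inv n = + 1 / n

ι-+ : ∀ m n → ι (m ℕ.+ n) ≡ ι m + ι n
ι-+ m n = trans (/-≡ (m ℕ.+ n) 1 (m ℕ.* 1 ℕ.+ n ℕ.* 1) 1 (lemma m n)) (sym (/-+ m 1 n 1))
  where
  lemma : ∀ m n → (m ℕ.+ n) ℕ.* 1 ≡ (m ℕ.* 1 ℕ.+ n ℕ.* 1) ℕ.* 1
  lemma = solve-∀

ι-* : ∀ m n → ι (m ℕ.* n) ≡ ι m * ι n
ι-* m n = sym (/-* m 1 n 1)

/-split : ∀ p q .{{_ : ℕ.NonZero q}} → + p / q ≡ ι p * inv q
/-split p q@(suc _) = trans (/-≡ p q (p ℕ.* 1) (1 ℕ.* q) (lemma p q)) (sym (/-* p 1 1 q))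
  where
  lemma : ∀ p q → p ℕ.* (1 ℕ.* q) ≡ p ℕ.* 1 ℕ.* q
  lemma = solve-∀

inv-* : ∀ m n .{{_ : ℕ.NonZero m}} .{{_ : ℕ.NonZero n}} .{{_ : ℕ.NonZero (m ℕ.* n)}} →
        inv (m ℕ.* n) ≡ inv m * inv n
inv-* m n = sym (/-* 1 m 1 n)

ι*inv : ∀ n .{{_ : ℕ.NonZero n}} → ι n * inv n ≡ 1ℚ
ι*inv n = trans (sym (/-split n n)) (/-≡ n n 1 1 (ℕ.*-comm n 1))

inv-anti : ∀ {m n} .{{_ : ℕ.NonZero m}} .{{_ : ℕ.NonZero n}} → m ℕ.≤ n → inv n ≤ inv m
inv-anti {m} {n} m≤n = /-mono 1 n 1 m (ℕ.*-monoʳ-≤ 1 m≤n)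

-- The ring solver treats reciprocals as free variables. Stating the inverse law as a vanishing
-- expression lets later identities carry explicit multiples of it and then drop them.
ι*inv-1 : ∀ n .{{_ : ℕ.NonZero n}} {x} → ι n ≡ x → x * inv n ℚ.- 1ℚ ≡ 0ℚ
ι*inv-1 n refl = cong (ℚ._- 1ℚ) (ι*inv n)

inv-^ : ∀ m k .{{_ : ℕ.NonZero m}} .{{_ : ℕ.NonZero (m ℕ.^ k)}} → inv (m ℕ.^ k) ≡ inv m ^ k
inv-^ m zero    = refl
inv-^ m (suc k) = trans (inv-* m (m ℕ.^ k)) (cong (inv m *_) (inv-^ m k))
  where instance _ = ℕ.m^n≢0 m k

ι-affine : ∀ p q n → ι (p ℕ.+ q ℕ.* n) ≡ ι p + ι q * ι n
ι-affine p q n = trans (ι-+ p (q ℕ.* n)) (cong (λ z → ι p + z) (ι-* q n))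

-- The WZ pair.

c : ℕ → ℕ → ℕ
c n k = 3 ℕ.+ 4 ℕ.* n ℕ.+ 2 ℕ.* k

-- w n k = n!² (1/2)ₖ / (3/2)₂ₙ₊ₖ and c n k / 2 is the next factor 3/2 + 2n + k.
w : ℕ → ℕ → ℚ
w zero    k = inv (1 ℕ.+ 2 ℕ.* k)
w (suc n) k = w n k * (+ (4 ℕ.* (suc n ℕ.* suc n)) / (c n k ℕ.* c n (suc k)))

w-sucˡ : ∀ n k → w (suc n) k ≡
         w n k * (ι 4 * (ι (suc n) * ι (suc n)) * (inv (c n k) * inv (c n (suc k))))
w-sucˡ n k = cong (w n k *_) (trans
  (/-split (4 ℕ.* (suc n ℕ.* suc n)) (c n k ℕ.* c n (suc k)))
  (cong₂ _*_ (trans (ι-* 4 (suc n ℕ.* suc n)) (cong (ι 4 *_) (ι-* (suc n) (suc n))))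
             (inv-* (c n k) (c n (suc k)))))

c-shift : ∀ n k → c (suc n) k ≡ c n (2 ℕ.+ k)
c-shift = lemma
  where
  lemma : ∀ n k → 3 ℕ.+ 4 ℕ.* suc n ℕ.+ 2 ℕ.* k ≡ 3 ℕ.+ 4 ℕ.* n ℕ.+ 2 ℕ.* (2 ℕ.+ k)
  lemma = solve-∀

-- The ratio is (1/2 + k) / (3/2 + 2n + k). Since `w` recurses on n only, it is proved by induction
-- on n: because `c (suc n) k` equals `c n (2 + k)`, the same three consecutive reciprocals occur on
-- both sides and only need regrouping.
w-sucʳ : ∀ n k → w n (suc k) ≡ w n k * (inv (c n k) * ι (1 ℕ.+ 2 ℕ.* k))
w-sucʳ zero k = trans (/-≡ 1 (1 ℕ.+ 2 ℕ.* suc k) 1 (c 0 k) (lemma k))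
  (trans (sym (*-identityˡ (inv (c 0 k))))
  (trans (cong (_* inv (c 0 k)) (sym (ι*inv (1 ℕ.+ 2 ℕ.* k))))
  (solve 3 (λ u i x → u :* i :* x := i :* (x :* u)) refl
    (ι (1 ℕ.+ 2 ℕ.* k)) (inv (1 ℕ.+ 2 ℕ.* k)) (inv (c 0 k)))))
  where
  lemma : ∀ k → 1 ℕ.* (3 ℕ.+ 2 ℕ.* k) ≡ 1 ℕ.* (1 ℕ.+ 2 ℕ.* suc k)
  lemma = solve-∀
w-sucʳ (suc n) k = begin
  w (suc n) (suc k)
    ≡⟨ w-sucˡ n (suc k) ⟩
  w n (suc k) * (N * (x₁ * inv (c n (2 ℕ.+ k))))
    ≡⟨ cong₂ (λ u v → u * (N * (x₁ * v))) (w-sucʳ n k) (/-cong {+ 1} refl (sym (c-shift n k))) ⟩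
  w n k * (x₀ * κ) * (N * (x₁ * x₂))
    ≡⟨ solve 6 (λ u x κ n y z → u :* (x :* κ) :* (n :* (y :* z)) := u :* (n :* (x :* y)) :* (z :* κ))
         refl (w n k) x₀ κ N x₁ x₂ ⟩
  w n k * (N * (x₀ * x₁)) * (x₂ * κ)
    ≡⟨ cong (_* (x₂ * κ)) (w-sucˡ n k) ⟨
  w (suc n) k * (x₂ * κ) ∎
  where
  open ≡-Reasoning
  N = ι 4 * (ι (suc n) * ι (suc n))
  κ = ι (1 ℕ.+ 2 ℕ.* k)
  x₀ = inv (c n k)
  x₁ = inv (c n (suc k))
  x₂ = inv (c (suc n) k)

r : ℕ → ℕ → ℚ
r n k = inv (1 ℕ.+ 2 ℕ.* (n ℕ.+ k))

-- Here `r n k` is 1/a. The bracket in `F` collects 4x² from a/(a² - 4x²) = 1/a + 4x²/a³ + ... and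
-- from (1±x)ₙ = n!² (1 - 4x² · Hₙ⁽²⁾/4 + ...). In `D` the factor -1/4 times -Hₙ⁽²⁾/4 gives 1/16,
-- and the last factor of (3/2)₂ₙ₊ₖ₊₁ is `c n k` / 2, whence 1/8.
F D G : ℕ → ℕ → ℚ
F n k = (- 1ℚ) ^ k * (w n k * r n k * (r n k * r n k ℚ.- + 1 / 4 * H⁽²⁾ n))
D n k = (- 1ℚ) ^ k * (w n k * inv (c n k) * (+ 1 / 8 * H⁽²⁾ n))
G n k = F n k + D n k

-- With b = 2N+κ, the difference of the two sides is a combination of bs-1,
-- (4N+κ)y-1 and N²h-1; the cofactors in the solver call exhibit it, by
-- N² + κ(4N+κ)/4 = b²/4 and κ + (4N+κ) = 2b.
wz-identity : ∀ σ w x N κ H h s y →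
  (ι 2 * N + κ) * s ℚ.- 1ℚ ≡ 0ℚ → (ι 4 * N + κ) * y ℚ.- 1ℚ ≡ 0ℚ → N * N * h ℚ.- 1ℚ ≡ 0ℚ →
  σ * (w * (ι 4 * (N * N) * (x * y)) * s * (s * s ℚ.- + 1 / 4 * (H + h)))
    + σ * (w * x * (+ 1 / 8 * H))
  ≡ (- 1ℚ) * σ * (w * (x * κ) * s * (s * s ℚ.- + 1 / 4 * H))
    + (- 1ℚ) * σ * (w * (x * κ) * y * (+ 1 / 8 * H))
wz-identity σ w x N κ H h s y e≡0 f≡0 g≡0 = trans
  (solve 9 (λ σ w x N κ H h s y →
    let b = con (ι 2) :* N :+ κ
        e = b :* s :- con 1ℚ
        f = (con (ι 4) :* N :+ κ) :* y :- con 1ℚ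
        g = N :* N :* h :- con 1ℚ
        ¼ = con (+ 1 / 4)
        ⅛ = con (+ 1 / 8)
    in σ :* (w :* (con (ι 4) :* (N :* N) :* (x :* y)) :* s :* (s :* s :- ¼ :* (H :+ h)))
         :+ σ :* (w :* x :* (⅛ :* H))
       := con (- 1ℚ) :* σ :* (w :* (x :* κ) :* s :* (s :* s :- ¼ :* H))
         :+ con (- 1ℚ) :* σ :* (w :* (x :* κ) :* y :* (⅛ :* H))
         :+ σ :* (w :* x) :* (y :* (s :* (e :+ con (ι 2)) :- ¼ :* (b :* H)) :* e
              :- y :* s :* g :- (⅛ :* H :+ κ :* (s :* (s :* s)) :- ¼ :* (κ :* (s :* H))) :* f))
    refl σ w x N κ H h s y)
  (trans (cong (λ z → R + z) (trans (cong (σ * (w * x) *_)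
      (trans (vanish e≡0 f≡0 g≡0)
        (solve 3 (λ p q t → p :* con 0ℚ :- q :* con 0ℚ :- t :* con 0ℚ := con 0ℚ) refl P (y * s) T)))
      (*-zeroʳ (σ * (w * x)))))
    (+-identityʳ R))
  where
  R = (- 1ℚ) * σ * (w * (x * κ) * s * (s * s ℚ.- + 1 / 4 * H))
    + (- 1ℚ) * σ * (w * (x * κ) * y * (+ 1 / 8 * H))
  P = y * (s * ((ι 2 * N + κ) * s ℚ.- 1ℚ + ι 2) ℚ.- + 1 / 4 * ((ι 2 * N + κ) * H))
  T = + 1 / 8 * H + κ * (s * (s * s)) ℚ.- + 1 / 4 * (κ * (s * H))
  vanish : ∀ {e f g} → e ≡ 0ℚ → f ≡ 0ℚ → g ≡ 0ℚ →
           P * e ℚ.- y * s * g ℚ.- T * f ≡ P * 0ℚ ℚ.- y * s * 0ℚ ℚ.- T * 0ℚ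
  vanish refl refl refl = refl

-- The pair relation with `F n k` cancelled on both sides, which G = F + D allows.
wz : ∀ n k → F (suc n) k + D n k ≡ G n (suc k)
wz n k = begin
  F (suc n) k + D n k
    ≡⟨ cong (λ u → σ * (u * s * (s * s ℚ.- + 1 / 4 * (H + h))) + D n k) (w-sucˡ n k) ⟩
  σ * (w n k * (ι 4 * (N * N) * (x * y)) * s * (s * s ℚ.- + 1 / 4 * (H + h))) + D n k
    ≡⟨ wz-identity σ (w n k) x N κ H h s y
         (ι*inv-1 (1 ℕ.+ 2 ℕ.* (suc n ℕ.+ k)) b≡) (ι*inv-1 (c n (suc k)) c≡)
         (ι*inv-1 (suc n ℕ.^ 2) n²≡) ⟩
  (- 1ℚ) * σ * (w n k * (x * κ) * s * (s * s ℚ.- + 1 / 4 * H))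
    + (- 1ℚ) * σ * (w n k * (x * κ) * y * (+ 1 / 8 * H))
    ≡⟨ cong₂ (λ u s → (- 1ℚ) * σ * (u * s * (s * s ℚ.- + 1 / 4 * H))
                    + (- 1ℚ) * σ * (u * y * (+ 1 / 8 * H)))
         -- `r` depends on n + k only, so `r n (suc k)` and `r (suc n) k` agree.
         (w-sucʳ n k) (/-cong {+ 1} refl (cong (λ m → 1 ℕ.+ 2 ℕ.* m) (ℕ.+-suc n k))) ⟨
  G n (suc k) ∎
  where
  open ≡-Reasoning
  σ = (- 1ℚ) ^ k
  N = ι (suc n)
  κ = ι (1 ℕ.+ 2 ℕ.* k)
  H = H⁽²⁾ n
  h = inv (suc n ℕ.^ 2)
  s = r (suc n) k
  x = inv (c n k)
  y = inv (c n (suc k))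
  b-nat : ∀ n k → 1 ℕ.+ 2 ℕ.* (suc n ℕ.+ k) ≡ 2 ℕ.* suc n ℕ.+ (1 ℕ.+ 2 ℕ.* k)
  b-nat = solve-∀
  c-nat : ∀ n k → 3 ℕ.+ 4 ℕ.* n ℕ.+ 2 ℕ.* suc k ≡ 4 ℕ.* suc n ℕ.+ (1 ℕ.+ 2 ℕ.* k)
  c-nat = solve-∀
  ι-split : ∀ m → ι (m ℕ.* suc n ℕ.+ (1 ℕ.+ 2 ℕ.* k)) ≡ ι m * N + κ
  ι-split m = trans (ι-+ (m ℕ.* suc n) _) (cong (_+ κ) (ι-* m (suc n)))
  b≡ : ι (1 ℕ.+ 2 ℕ.* (suc n ℕ.+ k)) ≡ ι 2 * N + κ
  b≡ = trans (cong ι (b-nat n k)) (ι-split 2)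
  c≡ : ι (c n (suc k)) ≡ ι 4 * N + κ
  c≡ = trans (cong ι (c-nat n k)) (ι-split 4)
  n²≡ : ι (suc n ℕ.^ 2) ≡ N * N
  n²≡ = trans (cong (λ m → ι (suc n ℕ.* m)) (ℕ.*-identityʳ (suc n))) (ι-* (suc n) (suc n))

-- The near sides: the terms of β(4) and of the series.

F-zero : ∀ k → F 0 k ≡ β4-term k
F-zero k = cong ((- 1ℚ) ^ k *_) (begin
  -- At n = 0 both `w` and `r` are 1/(1+2k) and the harmonic number vanishes, so only a fourth power
  -- remains.
  ρ * ρ * (ρ * ρ ℚ.- + 1 / 4 * 0ℚ)
    ≡⟨ solve 1 (λ ρ → ρ :* ρ :* (ρ :* ρ :- con (+ 1 / 4) :* con 0ℚ)
                    := ρ :* (ρ :* (ρ :* (ρ :* con 1ℚ)))) refl ρ ⟩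
  ρ * (ρ * (ρ * (ρ * 1ℚ)))
    ≡⟨ inv-^ (1 ℕ.+ 2 ℕ.* k) 4 ⟨
  inv ((1 ℕ.+ 2 ℕ.* k) ℕ.^ 4) ∎)
  where
  open ≡-Reasoning
  ρ = inv (1 ℕ.+ 2 ℕ.* k)

-- This is n!² / (5/2)₂ₙ, and the duplication formula (5/2)₂ₙ = 4ⁿ (5/4)ₙ (7/4)ₙ makes it the
-- hypergeometric factor of the series.
prefactor : ℕ → ℚ
prefactor n = + 3 / 1 * (w n 0 * inv (c n 0))

-- Induction on n: the new factors satisfy 4(5/4 + n) = `c n 1` and 4(7/4 + n) = `c n 2`, which
-- cancel the two new reciprocals. Of the remaining 4(n+1)²/16, the part (n+1)² feeds the squared
-- factorial and 1/4 the power.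
prefactor-* : ∀ n → prefactor n * (⟨ + 5 / 4 ⟩ n * ⟨ + 7 / 4 ⟩ n) ≡ (+ 1 / 4) ^ n * (⟨ 1ℚ ⟩ n) ^ 2
prefactor-* zero    = refl
prefactor-* (suc n) = begin
  + 3 / 1 * (w (suc n) 0 * inv (c (suc n) 0)) * (p * (+ 5 / 4 + ι n) * (q * (+ 7 / 4 + ι n)))
    ≡⟨ cong₂ (λ u v → + 3 / 1 * (u * v) * (p * (+ 5 / 4 + ι n) * (q * (+ 7 / 4 + ι n))))
         (trans (w-sucˡ n 0) (cong (λ N → w n 0 * (ι 4 * (N * N) * (inv (c n 0) * y))) (ι-+ 1 n)))
         (/-cong {+ 1} refl (c-shift n 0)) ⟩
  + 3 / 1 * (w n 0 * (ι 4 * ((1ℚ + ι n) * (1ℚ + ι n)) * (inv (c n 0) * y)) * z)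
    * (p * (+ 5 / 4 + ι n) * (q * (+ 7 / 4 + ι n)))
    ≡⟨ solve 7 (λ u x y z p q n →
         con (+ 3 / 1) :* (u :* (con (ι 4) :* ((con 1ℚ :+ n) :* (con 1ℚ :+ n)) :* (x :* y)) :* z)
           :* (p :* (con (+ 5 / 4) :+ n) :* (q :* (con (+ 7 / 4) :+ n)))
         := con (+ 3 / 1) :* (u :* x) :* (p :* q)
              :* (con (+ 1 / 4) :* ((con 1ℚ :+ n) :* (con 1ℚ :+ n)))
              :* ((con (ι 5) :+ con (ι 4) :* n) :* y) :* ((con (ι 7) :+ con (ι 4) :* n) :* z))
         refl (w n 0) (inv (c n 0)) y z p q (ι n) ⟩
  prefactor n * (p * q) * (+ 1 / 4 * ((1ℚ + ι n) * (1ℚ + ι n)))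
    * ((ι 5 + ι 4 * ι n) * y) * ((ι 7 + ι 4 * ι n) * z)
    ≡⟨ cong₃ (λ a b c → a * (+ 1 / 4 * ((1ℚ + ι n) * (1ℚ + ι n))) * b * c)
         (prefactor-* n) (inverse 1 5 (nat₅ n)) (inverse 2 7 (nat₇ n)) ⟩
  (+ 1 / 4) ^ n * (f * (f * 1ℚ)) * (+ 1 / 4 * ((1ℚ + ι n) * (1ℚ + ι n))) * 1ℚ * 1ℚ
    ≡⟨ solve 3 (λ a f m → a :* (f :* (f :* con 1ℚ)) :* (con (+ 1 / 4) :* (m :* m)) :* con 1ℚ :* con 1ℚ
         := con (+ 1 / 4) :* a :* (f :* m :* (f :* m :* con 1ℚ))) refl ((+ 1 / 4) ^ n) f (1ℚ + ι n) ⟩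
  (+ 1 / 4) ^ suc n * (⟨ 1ℚ ⟩ suc n) ^ 2 ∎
  where
  open ≡-Reasoning
  f = ⟨ 1ℚ ⟩ n
  p = ⟨ + 5 / 4 ⟩ n
  q = ⟨ + 7 / 4 ⟩ n
  y = inv (c n 1)
  z = inv (c n 2)
  nat₅ : ∀ n → 3 ℕ.+ 4 ℕ.* n ℕ.+ 2 ℕ.* 1 ≡ 5 ℕ.+ 4 ℕ.* n
  nat₅ = solve-∀
  nat₇ : ∀ n → 3 ℕ.+ 4 ℕ.* n ℕ.+ 2 ℕ.* 2 ≡ 7 ℕ.+ 4 ℕ.* n
  nat₇ = solve-∀
  inverse : ∀ j m → c n j ≡ m ℕ.+ 4 ℕ.* n → (ι m + ι 4 * ι n) * inv (c n j) ≡ 1ℚ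
  inverse j m eq = trans
    (cong (_* inv (c n j)) (sym (trans (cong ι eq) (ι-affine m 4 n)))) (ι*inv (c n j))
  cong₃ : ∀ (g : ℚ → ℚ → ℚ → ℚ) {a a′ b b′ c c′} →
          a ≡ a′ → b ≡ b′ → c ≡ c′ → g a b c ≡ g a′ b′ c′
  cong₃ g refl refl refl = refl

*-÷-unique : ∀ {x} p q d .{{_ : NonZero d}} → x * d ≡ p * q → p * (q ÷ d) ≡ x
*-÷-unique {x} p q d eq = begin
  p * (q * 1/ d)  ≡⟨ *-assoc p q (1/ d) ⟨
  p * q * 1/ d    ≡⟨ cong (_* 1/ d) eq ⟨
  x * d * 1/ d    ≡⟨ *-assoc x d (1/ d) ⟩
  x * (d * 1/ d)  ≡⟨ cong (x *_) (*-inverseʳ d) ⟩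
  x * 1ℚ          ≡⟨ *-identityʳ x ⟩
  x               ∎
  where open ≡-Reasoning

-- The cofactors come from 5+6n = 2(3+4n) - (1+2n) and 24+32n = 8(3+4n).
term-identity : ∀ w x ρ n H →
  (ι 3 + ι 4 * n) * x ℚ.- 1ℚ ≡ 0ℚ → (ι 1 + ι 2 * n) * ρ ℚ.- 1ℚ ≡ 0ℚ →
  + 3 / 1 * (w * x) * ((ι 5 + ι 6 * n) * ρ * H ℚ.- (ι 24 + ι 32 * n) * (ρ * (ρ * (ρ * 1ℚ))))
  ≡ (- (+ 24 / 1)) * (1ℚ * (w * ρ * (ρ * ρ ℚ.- + 1 / 4 * H)) + 1ℚ * (w * x * (+ 1 / 8 * H)))
term-identity w x ρ n H e≡0 f≡0 = trans
  (solve 5 (λ w x ρ n H →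
    con (+ 3 / 1) :* (w :* x) :* ((con (ι 5) :+ con (ι 6) :* n) :* ρ :* H
      :- (con (ι 24) :+ con (ι 32) :* n) :* (ρ :* (ρ :* (ρ :* con 1ℚ))))
    := con (- (+ 24 / 1)) :* (con 1ℚ :* (w :* ρ :* (ρ :* ρ :- con (+ 1 / 4) :* H))
                            :+ con 1ℚ :* (w :* x :* (con (+ 1 / 8) :* H)))
       :+ ((con (ι 6) :* (w :* ρ :* H) :- con (ι 24) :* (w :* (ρ :* ρ :* ρ)))
             :* ((con (ι 3) :+ con (ι 4) :* n) :* x :- con 1ℚ)
           :- con (ι 3) :* (w :* x :* H) :* ((con (ι 1) :+ con (ι 2) :* n) :* ρ :- con 1ℚ)))
    refl w x ρ n H)
  (trans (cong (λ z → R + z) (trans (cong₂ (λ e f → P * e ℚ.- Q * f) e≡0 f≡0)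
      (solve 2 (λ p q → p :* con 0ℚ :- q :* con 0ℚ := con 0ℚ) refl P Q)))
    (+-identityʳ R))
  where
  R = (- (+ 24 / 1)) * (1ℚ * (w * ρ * (ρ * ρ ℚ.- + 1 / 4 * H)) + 1ℚ * (w * x * (+ 1 / 8 * H)))
  P = ι 6 * (w * ρ * H) ℚ.- ι 24 * (w * (ρ * ρ * ρ))
  Q = ι 3 * (w * x * H)

term≡ : ∀ n → term n ≡ (- (+ 24 / 1)) * G n 0
term≡ n = begin
  term n
    ≡⟨ cong₂ _*_ (*-÷-unique {prefactor n} ((+ 1 / 4) ^ n) ((⟨ 1ℚ ⟩ n) ^ 2) d (prefactor-* n))
         (cong₂ (λ u v → u * H⁽²⁾ n ℚ.- v)
           (trans (/-split (5 ℕ.+ 6 ℕ.* n) (1 ℕ.+ 2 ℕ.* n)) (cong (_* ρ) (ι-affine 5 6 n)))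
           (trans (/-split (24 ℕ.+ 32 ℕ.* n) ((1 ℕ.+ 2 ℕ.* n) ℕ.^ 3))
             (cong₂ _*_ (ι-affine 24 32 n) (inv-^ (1 ℕ.+ 2 ℕ.* n) 3)))) ⟩
  prefactor n * ((ι 5 + ι 6 * ι n) * ρ * H⁽²⁾ n ℚ.- (ι 24 + ι 32 * ι n) * (ρ * (ρ * (ρ * 1ℚ))))
    ≡⟨ term-identity (w n 0) (inv (c n 0)) ρ (ι n) (H⁽²⁾ n)
         (ι*inv-1 (c n 0) (trans (cong ι (ℕ.+-identityʳ (3 ℕ.+ 4 ℕ.* n))) (ι-affine 3 4 n)))
         (ι*inv-1 (1 ℕ.+ 2 ℕ.* n) (ι-affine 1 2 n)) ⟩
  (- (+ 24 / 1)) * (1ℚ * (w n 0 * ρ * (ρ * ρ ℚ.- + 1 / 4 * H⁽²⁾ n)) + D n 0)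
    ≡⟨ cong (λ ρ → (- (+ 24 / 1)) * (1ℚ * (w n 0 * ρ * (ρ * ρ ℚ.- + 1 / 4 * H⁽²⁾ n)) + D n 0))
         (/-cong {+ 1} refl (cong (λ m → 1 ℕ.+ 2 ℕ.* m) (ℕ.+-identityʳ n))) ⟨
  (- (+ 24 / 1)) * G n 0 ∎
  where
  open ≡-Reasoning
  ρ = inv (1 ℕ.+ 2 ℕ.* n)
  d = ⟨ + 5 / 4 ⟩ n * ⟨ + 7 / 4 ⟩ n
  instance
    d≢0 : NonZero d
    d≢0 = pos⇒nonZero d {{pos*pos⇒pos
      (⟨ + 5 / 4 ⟩ n) {{⟨⟩-pos (+ 5 / 4) n}} (⟨ + 7 / 4 ⟩ n) {{⟨⟩-pos (+ 7 / 4) n}}}}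

-- Summation over a rectangle.

∑-row : ∀ n K → ∑[k< K ] (F (suc n)) + G n 0 ≡ ∑[k< K ] (F n) + G n K
∑-row n zero    = refl
∑-row n (suc K) = begin
  A + F (suc n) K + G n 0
    -- `D n K` is added and subtracted to expose the left side of `wz`; the `G` terms then telescope
    -- in k.
    ≡⟨ solve 4 (λ a f g d → a :+ f :+ g := (a :+ g) :+ ((f :+ d) :- d)) refl
         A (F (suc n) K) (G n 0) (D n K) ⟩
  A + G n 0 + (F (suc n) K + D n K ℚ.- D n K)
    ≡⟨ cong₂ (λ u v → u + (v ℚ.- D n K)) (∑-row n K) (wz n K) ⟩
  B + (F n K + D n K) + (G n (suc K) ℚ.- D n K)
    ≡⟨ solve 4 (λ b f d g → b :+ (f :+ d) :+ (g :- d) := b :+ f :+ g) refl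
         B (F n K) (D n K) (G n (suc K)) ⟩
  B + F n K + G n (suc K) ∎
  where
  open ≡-Reasoning
  A = ∑[k< K ] (F (suc n))
  B = ∑[k< K ] (F n)

-- A discrete Green formula: adding the row identities for n < N telescopes the `F` sums, and only
-- the four sides of the rectangle survive.
∑-rectangle : ∀ N K → ∑[k< K ] (F N) + ∑[k< N ] (λ n → G n 0)
                    ≡ ∑[k< K ] (F 0) + ∑[k< N ] (λ n → G n K)
∑-rectangle zero    K = refl
∑-rectangle (suc N) K = begin
  A + (S + G N 0)  ≡⟨ solve 3 (λ a s g → a :+ (s :+ g) := (a :+ g) :+ s) refl A S (G N 0) ⟩
  A + G N 0 + S    ≡⟨ cong (_+ S) (∑-row N K) ⟩
  B + G N K + S    ≡⟨ solve 3 (λ b g s → b :+ g :+ s := (b :+ s) :+ g) refl B (G N K) S ⟩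
  B + S + G N K    ≡⟨ cong (_+ G N K) (∑-rectangle N K) ⟩
  ∑[k< K ] (F 0) + T + G N K ≡⟨ +-assoc (∑[k< K ] (F 0)) T (G N K) ⟩
  ∑[k< K ] (F 0) + (T + G N K) ∎
  where
  open ≡-Reasoning
  A = ∑[k< K ] (F (suc N))
  B = ∑[k< K ] (F N)
  S = ∑[k< N ] (λ n → G n 0)
  T = ∑[k< N ] (λ n → G n K)

∑-cong : ∀ {a b : ℕ → ℚ} → (∀ k → a k ≡ b k) → ∀ n → ∑[k< n ] a ≡ ∑[k< n ] b
∑-cong eq zero    = refl
∑-cong eq (suc n) = cong₂ _+_ (∑-cong eq n) (eq n)

∑-*ˡ : ∀ q (a : ℕ → ℚ) n → ∑[k< n ] (λ k → q * a k) ≡ q * ∑[k< n ] a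
∑-*ˡ q a zero    = sym (*-zeroʳ q)
∑-*ˡ q a (suc n) = trans (cong (_+ q * a n) (∑-*ˡ q a n)) (sym (*-distribˡ-+ q (∑[k< n ] a) (a n)))

error-formula : ∀ N K → ∑[k< N ] term ℚ.- (- (+ 24 / 1)) * ∑[k< K ] β4-term
                ≡ + 24 / 1 * (∑[k< K ] (F N) ℚ.- ∑[k< N ] (λ n → G n K))
error-formula N K = begin
  ∑[k< N ] term ℚ.- q * ∑[k< K ] β4-term
    ≡⟨ cong₂ (λ u v → u ℚ.- q * v)
         (trans (∑-cong term≡ N) (∑-*ˡ q (λ n → G n 0) N)) (sym (∑-cong F-zero K)) ⟩
  q * S ℚ.- q * B
    -- The far side `A` is inserted and subtracted so that `∑-rectangle` applies to A + S.
    ≡⟨ solve 3 (λ a b s → con q :* s :- con q :* b := con q :* ((a :+ s) :- a :- b)) refl A B S ⟩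
  q * (A + S ℚ.- A ℚ.- B)
    ≡⟨ cong (λ u → q * (u ℚ.- A ℚ.- B)) (∑-rectangle N K) ⟩
  q * (B + T ℚ.- A ℚ.- B)
    ≡⟨ solve 3 (λ a b t → con q :* ((b :+ t) :- a :- b) := con (+ 24 / 1) :* (a :- t)) refl A B T ⟩
  + 24 / 1 * (A ℚ.- T) ∎
  where
  open ≡-Reasoning
  q = - (+ 24 / 1)
  A = ∑[k< K ] (F N)
  B = ∑[k< K ] (F 0)
  S = ∑[k< N ] (λ n → G n 0)
  T = ∑[k< N ] (λ n → G n K)

-- Bounds for the far sides.

infix 4 _∈[0,_]
_∈[0,_] : ℚ → ℚ → Set
x ∈[0, b ] = 0ℚ ≤ x × x ≤ b

*-∈ : ∀ {x y s t} → x ∈[0, s ] → y ∈[0, t ] → x * y ∈[0, s * t ]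
*-∈ {x} {y} {s} {t} (0≤x , x≤s) (0≤y , y≤t) =
  nonNegative⁻¹ (x * y) {{nonNeg*nonNeg⇒nonNeg x {{nonNegative 0≤x}} y {{nonNegative 0≤y}}}} ,
  ≤-trans (*-monoʳ-≤-nonNeg y {{nonNegative 0≤y}} x≤s)
          (*-monoˡ-≤-nonNeg s {{nonNegative (≤-trans 0≤x x≤s)}} y≤t)

∣∣≤-of-∈ : ∀ {x b} → x ∈[0, b ] → ℚ.∣ x ∣ ≤ b
∣∣≤-of-∈ (0≤x , x≤b) = ≤-trans (≤-reflexive (0≤p⇒∣p∣≡p 0≤x)) x≤b

-- Both numbers are nonnegative, so the bound is b and not 2b; this keeps the bracket of `F` within
-- 1.
∣-∣≤ : ∀ {x y b} → x ∈[0, b ] → y ∈[0, b ] → ℚ.∣ x ℚ.- y ∣ ≤ b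
∣-∣≤ {x} {y} {b} (0≤x , x≤b) (0≤y , y≤b) with ∣p∣≡p∨∣p∣≡-p (x ℚ.- y)
... | inj₁ eq = ≤-trans (≤-reflexive eq)
  (≤-trans (+-mono-≤ x≤b (neg-antimono-≤ 0≤y)) (≤-reflexive (+-identityʳ b)))
... | inj₂ eq = ≤-trans (≤-reflexive (trans eq (solve 2 (λ x y → :- (x :- y) := y :- x) refl x y)))
  (≤-trans (+-mono-≤ y≤b (neg-antimono-≤ 0≤x)) (≤-reflexive (+-identityʳ b)))

inv-∈ : ∀ {m n} .{{_ : ℕ.NonZero m}} .{{_ : ℕ.NonZero n}} → m ℕ.≤ n → inv n ∈[0, inv m ]
inv-∈ {m} {n} m≤n = /-nonNeg 1 n , inv-anti m≤n

-- The summand 2/(n+1) makes the induction work: 1/(n+1)² ≤ 2/(n+1) - 2/(n+2), because n + 2 ≤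
-- 2(n+1).
H⁽²⁾-bound : ∀ n → H⁽²⁾ n + + 2 / suc n ≤ + 2 / 1
H⁽²⁾-bound zero    = ≤-refl
H⁽²⁾-bound (suc n) = begin
  H⁽²⁾ n + inv (suc n ℕ.^ 2) + + 2 / (2 ℕ.+ n)
    ≡⟨ +-assoc (H⁽²⁾ n) (inv (suc n ℕ.^ 2)) (+ 2 / (2 ℕ.+ n)) ⟩
  H⁽²⁾ n + (inv (suc n ℕ.^ 2) + + 2 / (2 ℕ.+ n))
    ≤⟨ +-monoʳ-≤ (H⁽²⁾ n) (≤-trans (≤-reflexive (/-+ 1 (suc n ℕ.^ 2) 2 (2 ℕ.+ n)))
         (/-mono (1 ℕ.* (2 ℕ.+ n) ℕ.+ 2 ℕ.* suc n ℕ.^ 2) (suc n ℕ.^ 2 ℕ.* (2 ℕ.+ n)) 2 (suc n)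
           (ℕ.≤-trans (ℕ.m≤m+n _ (n ℕ.* suc n)) (ℕ.≤-reflexive (lemma n))))) ⟩
  H⁽²⁾ n + + 2 / suc n
    ≤⟨ H⁽²⁾-bound n ⟩
  + 2 / 1 ∎
  where
  open ≤-Reasoning
  lemma : ∀ n → (1 ℕ.* (2 ℕ.+ n) ℕ.+ 2 ℕ.* (suc n ℕ.* (suc n ℕ.* 1))) ℕ.* suc n ℕ.+ n ℕ.* suc n
              ≡ 2 ℕ.* (suc n ℕ.* (suc n ℕ.* 1) ℕ.* (2 ℕ.+ n))
  lemma = solve-∀

H⁽²⁾-∈ : ∀ n → H⁽²⁾ n ∈[0, + 2 / 1 ]
H⁽²⁾-∈ n = nonneg n , (begin
  H⁽²⁾ n                ≡⟨ +-identityʳ (H⁽²⁾ n) ⟨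
  H⁽²⁾ n + 0ℚ           ≤⟨ +-monoʳ-≤ (H⁽²⁾ n) (/-nonNeg 2 (suc n)) ⟩
  H⁽²⁾ n + + 2 / suc n  ≤⟨ H⁽²⁾-bound n ⟩
  + 2 / 1               ∎)
  where
  open ≤-Reasoning
  nonneg : ∀ n → 0ℚ ≤ H⁽²⁾ n
  nonneg zero    = ≤-refl
  nonneg (suc n) = +-mono-≤ (nonneg n) (/-nonNeg 1 (suc n ℕ.^ 2))

H⁽²⁾-scaled-∈ : ∀ q → 0ℚ ≤ q → q * (+ 2 / 1) ≤ 1ℚ → ∀ n → q * H⁽²⁾ n ∈[0, 1ℚ ]
H⁽²⁾-scaled-∈ q 0≤q 2q≤1 n =
  let 0≤ , ≤2q = *-∈ (0≤q , ≤-refl) (H⁽²⁾-∈ n) in 0≤ , ≤-trans ≤2q 2q≤1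

-- By induction on n it suffices that 4(n+1)² (n+k+2) ≤ (n+k+1) · `c n k` · `c n (suc k)`; the
-- difference is the polynomial in `lemma`, whose coefficients are all nonnegative. The bound
-- depends on n + k alone, so it serves both far sides.
w-∈ : ∀ n k → w n k ∈[0, inv (suc (n ℕ.+ k)) ]
w-∈ zero    k = inv-∈ (ℕ.s≤s (ℕ.m≤m+n k (k ℕ.+ 0)))
w-∈ (suc n) k =
  let 0≤ , ≤b = *-∈ (w-∈ n k) (/-nonNeg p q , ≤-refl)
  in 0≤ , (begin
    w (suc n) k                      ≤⟨ ≤b ⟩
    inv (suc (n ℕ.+ k)) * (+ p / q)  ≡⟨ /-* 1 (suc (n ℕ.+ k)) p q ⟩
    + (1 ℕ.* p) / (suc (n ℕ.+ k) ℕ.* q)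
      ≤⟨ /-mono (1 ℕ.* p) (suc (n ℕ.+ k) ℕ.* q) 1 (suc (suc n ℕ.+ k))
           (ℕ.≤-trans (ℕ.m≤m+n _ _) (ℕ.≤-reflexive (lemma n k))) ⟩
    inv (suc (suc n ℕ.+ k))          ∎)
  where
  open ≤-Reasoning
  p = 4 ℕ.* (suc n ℕ.* suc n)
  q = c n k ℕ.* c n (suc k)
  lemma : ∀ n k →
    1 ℕ.* (4 ℕ.* (suc n ℕ.* suc n)) ℕ.* (2 ℕ.+ (n ℕ.+ k))
      ℕ.+ (12 ℕ.* (n ℕ.* n ℕ.* n) ℕ.+ 28 ℕ.* (n ℕ.* n ℕ.* k) ℕ.+ 20 ℕ.* (n ℕ.* k ℕ.* k)
           ℕ.+ 4 ℕ.* (k ℕ.* k ℕ.* k) ℕ.+ 32 ℕ.* (n ℕ.* n) ℕ.+ 56 ℕ.* (n ℕ.* k) ℕ.+ 20 ℕ.* (k ℕ.* k)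
           ℕ.+ 27 ℕ.* n ℕ.+ 27 ℕ.* k ℕ.+ 7)
    ≡ 1 ℕ.* (suc (n ℕ.+ k) ℕ.* ((3 ℕ.+ 4 ℕ.* n ℕ.+ 2 ℕ.* k) ℕ.* (3 ℕ.+ 4 ℕ.* n ℕ.+ 2 ℕ.* suc k)))
  lemma = solve-∀

∣sign*∣ : ∀ k x → ℚ.∣ (- 1ℚ) ^ k * x ∣ ≡ ℚ.∣ x ∣
∣sign*∣ zero    x = cong ℚ.∣_∣ (*-identityˡ x)
∣sign*∣ (suc k) x = begin
  ℚ.∣ (- 1ℚ) * (- 1ℚ) ^ k * x ∣
    ≡⟨ cong ℚ.∣_∣ (solve 2 (λ s x → con (- 1ℚ) :* s :* x := :- (s :* x)) refl ((- 1ℚ) ^ k) x) ⟩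
  ℚ.∣ - ((- 1ℚ) ^ k * x) ∣  ≡⟨ ∣-p∣≡∣p∣ ((- 1ℚ) ^ k * x) ⟩
  ℚ.∣ (- 1ℚ) ^ k * x ∣      ≡⟨ ∣sign*∣ k x ⟩
  ℚ.∣ x ∣                   ∎
  where open ≡-Reasoning

-- Estimates beyond the antidiagonal n + k = m. With m = N they cover the side n = N and the side k
-- = N at once.
module _ {m : ℕ} (n k : ℕ) (m≤n+k : m ℕ.≤ n ℕ.+ k) where

  private
    t = inv (suc m)

    w∈ : w n k ∈[0, t ]
    w∈ = let 0≤w , w≤ = w-∈ n k in 0≤w , ≤-trans w≤ (inv-anti (ℕ.s≤s m≤n+k))

    r∈ : ∀ {l} → l ℕ.≤ n ℕ.+ k → r n k ∈[0, inv (suc l) ]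
    r∈ l≤n+k = inv-∈ (ℕ.s≤s (ℕ.≤-trans l≤n+k (ℕ.m≤m+n (n ℕ.+ k) _)))

    1/c∈ : inv (c n k) ∈[0, t ]
    1/c∈ = inv-∈ (ℕ.≤-trans (ℕ.s≤s m≤n+k)
      (ℕ.≤-trans (ℕ.m≤m+n (suc (n ℕ.+ k)) _) (ℕ.≤-reflexive (lemma n k))))
      where
      lemma : ∀ n k → suc (n ℕ.+ k) ℕ.+ (2 ℕ.+ 3 ℕ.* n ℕ.+ k) ≡ 3 ℕ.+ 4 ℕ.* n ℕ.+ 2 ℕ.* k
      lemma = solve-∀

  ∣F∣≤ : ℚ.∣ F n k ∣ ≤ t * t
  ∣F∣≤ = begin
    ℚ.∣ F n k ∣
      ≡⟨ trans (∣sign*∣ k _) (∣p*q∣≡∣p∣*∣q∣ (w n k * r n k) d) ⟩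
    ℚ.∣ w n k * r n k ∣ * ℚ.∣ d ∣
      ≤⟨ proj₂ (*-∈ (0≤∣p∣ (w n k * r n k) , ∣∣≤-of-∈ (*-∈ w∈ (r∈ m≤n+k)))
                    -- Inside the bracket `r` is bounded only by 1 (the case l = 0), since the
                    -- harmonic part does not decay; the two factors t come from `w` and the outer
                    -- `r`.
                    (0≤∣p∣ d , ∣-∣≤ (*-∈ (r∈ ℕ.z≤n) (r∈ ℕ.z≤n))
             (H⁽²⁾-scaled-∈ (+ 1 / 4) (/-nonNeg 1 4) (/-mono 1 2 1 1 (ℕ.s≤s ℕ.z≤n)) n))) ⟩
    t * t * 1ℚ
      ≡⟨ *-identityʳ (t * t) ⟩
    t * t ∎
    where
    open ≤-Reasoning
    d = r n k * r n k ℚ.- + 1 / 4 * H⁽²⁾ n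

  ∣D∣≤ : ℚ.∣ D n k ∣ ≤ t * t
  ∣D∣≤ = begin
    ℚ.∣ D n k ∣
      ≡⟨ ∣sign*∣ k _ ⟩
    ℚ.∣ w n k * inv (c n k) * (+ 1 / 8 * H⁽²⁾ n) ∣
      ≤⟨ ∣∣≤-of-∈ (*-∈ (*-∈ w∈ 1/c∈)
           (H⁽²⁾-scaled-∈ (+ 1 / 8) (/-nonNeg 1 8) (/-mono 1 4 1 1 (ℕ.s≤s ℕ.z≤n)) n)) ⟩
    t * t * 1ℚ
      ≡⟨ *-identityʳ (t * t) ⟩
    t * t ∎
    where open ≤-Reasoning

  ∣G∣≤ : ℚ.∣ G n k ∣ ≤ t * t + t * t
  ∣G∣≤ = ≤-trans (∣p+q∣≤∣p∣+∣q∣ (F n k) (D n k)) (+-mono-≤ ∣F∣≤ ∣D∣≤)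

-- Error estimate and passage to the limit.

∣∑∣≤ : ∀ (a : ℕ → ℚ) {b} → (∀ k → ℚ.∣ a k ∣ ≤ b) → ∀ n → ℚ.∣ ∑[k< n ] a ∣ ≤ ι n * b
∣∑∣≤ a {b} h zero    = ≤-reflexive (sym (*-zeroˡ b))
∣∑∣≤ a {b} h (suc n) = begin
  ℚ.∣ ∑[k< n ] a + a n ∣        ≤⟨ ∣p+q∣≤∣p∣+∣q∣ (∑[k< n ] a) (a n) ⟩
  ℚ.∣ ∑[k< n ] a ∣ + ℚ.∣ a n ∣  ≤⟨ +-mono-≤ (∣∑∣≤ a h n) (h n) ⟩
  ι n * b + b                   ≡⟨ solve 2 (λ n b → n :* b :+ b := (con 1ℚ :+ n) :* b) refl (ι n) b ⟩
  (1ℚ + ι n) * b                ≡⟨ cong (_* b) (ι-+ 1 n) ⟨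
  ι (suc n) * b                 ∎
  where open ≤-Reasoning

-- On the square K = N each far side has N terms, bounded by t² for `F` and 2t² for `G` with t =
-- 1/(N+1). The total 24 · 3 · N t² is at most 72 t because N t ≤ 1.
error-bound : ∀ N → ℚ.∣ ∑[k< N ] term ℚ.- (- (+ 24 / 1)) * ∑[k< N ] β4-term ∣ ≤ + 72 / suc N
error-bound N = begin
  ℚ.∣ ∑[k< N ] term ℚ.- (- (+ 24 / 1)) * ∑[k< N ] β4-term ∣
    ≡⟨ trans (cong ℚ.∣_∣ (error-formula N N)) (∣p*q∣≡∣p∣*∣q∣ (+ 24 / 1) (A ℚ.- T)) ⟩
  + 24 / 1 * ℚ.∣ A ℚ.- T ∣
    ≤⟨ *-monoˡ-≤-nonNeg (+ 24 / 1) (≤-trans (∣p+q∣≤∣p∣+∣q∣ A (- T))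
         (+-mono-≤ (∣∑∣≤ (F N) (λ k → ∣F∣≤ N k (ℕ.m≤m+n N k)) N)
           (≤-trans (≤-reflexive (∣-p∣≡∣p∣ T))
                    (∣∑∣≤ (λ n → G n N) (λ n → ∣G∣≤ n N (ℕ.m≤n+m N n)) N)))) ⟩
  + 24 / 1 * (ι N * (t * t) + ι N * (t * t + t * t))
    ≡⟨ solve 2 (λ n t → con (+ 24 / 1) :* (n :* (t :* t) :+ n :* (t :* t :+ t :* t))
                      := con (+ 72 / 1) :* (n :* t :* t)) refl (ι N) t ⟩
  + 72 / 1 * (ι N * t * t)
    ≤⟨ *-monoˡ-≤-nonNeg (+ 72 / 1) (*-monoʳ-≤-nonNeg t {{nonNegative (/-nonNeg 1 (suc N))}} Nt≤1) ⟩
  + 72 / 1 * (1ℚ * t)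
    ≡⟨ cong (+ 72 / 1 *_) (*-identityˡ t) ⟩
  + 72 / 1 * t
    ≡⟨ /-split 72 (suc N) ⟨
  + 72 / suc N ∎
  where
  open ≤-Reasoning
  t = inv (suc N)
  A = ∑[k< N ] (F N)
  T = ∑[k< N ] (λ n → G n N)
  Nt≤1 : ι N * t ≤ 1ℚ
  Nt≤1 = ≤-trans (≤-reflexive (sym (/-split N (suc N))))
    (/-mono N (suc N) 1 1 (ℕ.≤-trans (ℕ.≤-reflexive (ℕ.*-identityʳ N))
      (ℕ.≤-trans (ℕ.n≤1+n N) (ℕ.≤-reflexive (sym (ℕ.*-identityˡ (suc N)))))))

/suc-eventually-< : ∀ C ε → 0ℚ ℚ.< ε → ∃ λ N → ∀ n → N ℕ.≤ n → + C / suc n ℚ.< ε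
/suc-eventually-< C ε 0<ε = go ε {{positive 0<ε}}
  where
  go : ∀ ε → .{{Positive ε}} → ∃ λ N → ∀ n → N ℕ.≤ n → + C / suc n ℚ.< ε
  -- For ε = (p+1)/(q+1) the claim reads C (q+1) < (p+1)(n+1), which already follows from C (q+1) ≤
  -- n.
  go ε@(mkℚ +[1+ p ] q _) = C ℕ.* suc q , λ n N≤n → toℚᵘ-cancel-< (begin-strict
    toℚᵘ (+ C / suc n)  ≃⟨ toℚᵘ-/ C (suc n) ⟩
    + C ℚᵘ./ suc n      <⟨ ℚᵘ.*<* (subst (ℤ._< _) (ℤ.pos-* C (suc q))
                             (ℤ.+<+ (ℕ.≤-trans (ℕ.s≤s N≤n) (ℕ.m≤m+n (suc n) (p ℕ.* suc n))))) ⟩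
    toℚᵘ ε              ∎)
    where open ℚᵘ.≤-Reasoning

-- The order on `ℝ` asks for a rational gap, so ε is halved: one half δ is the gap, and the other is
-- split between the distance to the n-th approximant of `x` and the Cauchy distance between
-- approximants.
hasSum-of-close : ∀ a x →
                  (∀ ε → 0ℚ ℚ.< ε → ∃ λ N → ∀ n → N ℕ.≤ n → ℚ.∣ ∑[k< n ] a ℚ.- seq x n ∣ ℚ.< ε) →
                  HasSum a x
hasSum-of-close a x close ε 0<ε =
  let δ = ½ * ε
      0<δ = pos½* 0<ε
      M , f = close (½ * δ) (pos½* 0<δ)
      N , g = cauchy x (½ * δ) (pos½* 0<δ)
  in M ℕ.⊔ N , λ n M⊔N≤n → δ , 0<δ , N , λ m N≤m →
    let S = ∑[k< n ] a
        open ≤-Reasoning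
    in begin
      ℚ.∣ S ℚ.- seq x m ∣ + δ
        ≤⟨ +-monoˡ-≤ δ (<⇒≤ (∣+∣<-halves δ (S ℚ.- seq x n) (seq x n ℚ.- seq x m)
             (solve 3 (λ s u v → s :- v := (s :- u) :+ (u :- v)) refl S (seq x n) (seq x m))
             (f n (ℕ.m⊔n≤o⇒m≤o M N M⊔N≤n)) (g n m (ℕ.m⊔n≤o⇒n≤o M N M⊔N≤n) N≤m))) ⟩
      δ + δ
        ≡⟨ halves ε ⟩
      ε ∎

theorem1p3 : HasSum term ((- (+ 24 / 1)) · β4)
theorem1p3 = hasSum-of-close term ((- (+ 24 / 1)) · β4) λ ε 0<ε →
  let N , f = /suc-eventually-< 72 ε 0<ε
  -- The n-th approximant of the scaled `β4` is by definition -24 times the n-th partial sum, so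
  -- `error-bound` speaks of exactly this distance.
  in N , λ n N≤n → ≤-<-trans (error-bound n) (f n N≤n)
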